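{- Let $k,\Delta\geq 2$ with $\Delta\leq k$, and let $T$ be any $[\Delta,k]$-transversal design. Let $U$ be any block of $T$ and let $t_1,t_2,\ldots,t_\Delta$ be any $\Delta$ nodes or blocks of $T$ (repetitions allowed). Then there are paths $\pi_1,\ldots,\pi_\Delta$ in $T$, where $\pi_i$ goes from $U$ to $t_i$ and has length at most $7$, such that these paths are pairwise edge-disjoint.
   Context: A $[\Delta,k]$-transversal design ($k,\Delta\ge2$) is a set of $\Delta k$ elements partitioned into $\Delta$ groups of size $k$, with a family of $k^2$ blocks, each a $\Delta$-subset meeting every group in exactly one element, such that every pair of elements from distinct groups lies in exactly one block. It is viewed as a bipartite graph with the elements as nodes, the blocks as blocks, and a node adjacent to a block iff it belongs to it. A path is a sequence of distinct vertices with consecutive ones adjacent; its length is its number of edges. A set of paths is pairwise edge-disjoint if no edge is traversed by more than one of the paths (counted over all paths, at most once). -}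

module Defs where

open import Data.Nat using (ℕ; zero; suc; _*_)
open import Data.Fin using (Fin)
open import Data.Product using (Σ; _×_; _,_; proj₁; proj₂)
open import Data.Sum using (_⊎_; inj₁; inj₂)
open import Data.List using (List; []; _∷_; concatMap; length)
open import Data.List.Relation.Unary.Unique.Propositional using (Unique)
open import Relation.Binary.PropositionalEquality using (_≡_; _≢_)

-- Elements (nodes) of a [Δ,k]-transversal design: group g ∈ Fin Δ, position x ∈ Fin k.
Node : ℕ → ℕ → Set
Node Δ k = Fin Δ × Fin k

BlockIx : ℕ → Set
BlockIx k = Fin k × Fin k

-- A [Δ,k]-transversal design: k² blocks; each block meets every group in exactly
-- one element, so a block is given by the function  group ↦ its element in that group.
-- Every pair of elements from distinct groups lies in exactly one block.
record TD (Δ k : ℕ) : Set where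
  field
    blk  : BlockIx k → Fin Δ → Fin k
    pair : ∀ (g g' : Fin Δ) → g ≢ g' → ∀ (x y : Fin k) →
           Σ (BlockIx k) (λ b → (blk b g ≡ x × blk b g' ≡ y) ×
             (∀ b' → blk b' g ≡ x → blk b' g' ≡ y → b' ≡ b))

Vertex : ℕ → ℕ → Set
Vertex Δ k = Node Δ k ⊎ BlockIx k

node : ∀ {Δ k} → Node Δ k → Vertex Δ k
node = inj₁

block : ∀ {Δ k} → BlockIx k → Vertex Δ k
block = inj₂

-- An edge of the incidence graph joins block b with the node (g , blk b g);
-- it is therefore determined by the pair (b , g).
Edge : ℕ → ℕ → Set
Edge Δ k = BlockIx k × Fin Δ

module _ {Δ k : ℕ} (T : TD Δ k) where
  open TD T

  data Adj : Vertex Δ k → Vertex Δ k → Set where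
    nb : ∀ {g x b} → blk b g ≡ x → Adj (node (g , x)) (block b)
    bn : ∀ {g x b} → blk b g ≡ x → Adj (block b) (node (g , x))

  adjEdge : ∀ {u v} → Adj u v → Edge Δ k
  adjEdge (nb {g} {x} {b} _) = b , g
  adjEdge (bn {g} {x} {b} _) = b , g

  data Walk : Vertex Δ k → Vertex Δ k → Set where
    stop : ∀ {v} → Walk v v
    step : ∀ {u w v} → Adj u w → Walk w v → Walk u v

  vertices : ∀ {u v} → Walk u v → List (Vertex Δ k)
  vertices {u} stop = u ∷ []
  vertices {u} (step _ w) = u ∷ vertices w

  edges : ∀ {u v} → Walk u v → List (Edge Δ k)
  edges stop = []
  edges (step a w) = adjEdge a ∷ edges w

  len : ∀ {u v} → Walk u v → ℕ
  len stop = 0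
  len (step _ w) = suc (len w)

  record Path (u v : Vertex Δ k) : Set where
    constructor path
    field
      walk     : Walk u v
      distinct : Unique (vertices walk)

{-# OPTIONS --safe #-}
module Submission where

open import Defs
open import Data.Nat using (ℕ; suc; _≤_; z≤n; s≤s)
open import Data.Nat.Properties using (≤-refl; ≤-trans; m≤n⇒m≤1+n; 1+n≰n)
open import Data.Fin using (Fin; zero; suc; inject≤)
open import Data.Fin.Properties using (_≟_; any?; all?; ¬∀⟶∃¬; injective⇒≤; inject≤-injective)
open import Data.Fin.Permutation using (Permutation′; _⟨$⟩ʳ_; _⟨$⟩ˡ_; inverseˡ; inverseʳ; transpose; _∘ₚ_) renaming (id to idₚ)
open import Data.Product using (Σ; ∃; _×_; _,_; proj₁; proj₂)
open import Data.Product.Properties using () renaming (≡-dec to ×-≡-dec)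
open import Data.Sum using (_⊎_; inj₁; inj₂)
open import Data.Sum.Properties using () renaming (≡-dec to ⊎-≡-dec)
open import Data.Empty using (⊥; ⊥-elim)
open import Data.List using (List; concatMap; allFin; []; _∷_)
open import Data.List.Membership.Propositional using (_∈_)
import Data.List.Membership.DecPropositional as DecMembership
open import Data.List.Relation.Unary.All as All using (All; []; _∷_)
import Data.List.Relation.Unary.All.Properties as All
open import Data.List.Relation.Unary.Any using (here; there)
open import Data.List.Relation.Unary.AllPairs as AllPairs using ([]; _∷_)
import Data.List.Relation.Unary.AllPairs.Properties as AllPairs
open import Data.List.Relation.Binary.Disjoint.Propositional using (Disjoint)
open import Data.List.Relation.Unary.Unique.Propositional using (Unique)
import Data.List.Relation.Unary.Unique.Propositional.Properties as Unique
open import Function using (_∘_)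
open import Relation.Nullary using (¬_; Dec; yes; no; ¬?; _×-dec_)
open import Relation.Binary.Definitions using (DecidableEquality)
open import Relation.Binary.PropositionalEquality using (_≡_; _≢_; refl; sym; trans; cong; subst)

-- Write u_g for the node of U in group g. Whenever some target is u_g or a block ≠ U through u_g,
-- one such target (u_g itself if it occurs) is served directly through u_g. Every other target
-- i gets a node e_i off U in a group h_i: the target itself if it is a node off U, a node of the
-- target if it is a block, a node of a block returning to u_g if the target is u_g. Its path leaves
-- U through a u_s with s ≠ h_i, crosses the unique block joining u_s to e_i, and finishes in at
-- most two more steps. A block other than U meets U in at most one node, so the crossing blocks
-- differ from each other and from the blocks used to finish. Exchanging the groups s among the
-- targets achieves s ≠ h_i throughout, unless all h_i equal some c; then one path leaves through
-- u_c and makes a detour of two more steps over a block through e_i that avoids U.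

-- Finite combinatorics

another : ∀ {n} → 2 ≤ n → (g : Fin n) → ∃ λ d → d ≢ g
another (s≤s (s≤s _)) zero    = suc zero , λ ()
another (s≤s (s≤s _)) (suc _) = zero , λ ()

transpose-left : ∀ {n} (i j : Fin n) → transpose i j ⟨$⟩ʳ i ≡ j
transpose-left i j with i ≟ i
... | yes _   = refl
... | no  i≢i = ⊥-elim (i≢i refl)

transpose-right : ∀ {n} (i j : Fin n) → transpose i j ⟨$⟩ʳ j ≡ i
transpose-right i j with j ≟ i
... | yes j≡i = j≡i
... | no  _ with j ≟ j
...   | yes _   = refl
...   | no  j≢j = ⊥-elim (j≢j refl)

transpose-other : ∀ {n} (i j m : Fin n) → m ≢ i → m ≢ j → transpose i j ⟨$⟩ʳ m ≡ m
transpose-other i j m m≢i m≢j with m ≟ i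
... | yes m≡i = ⊥-elim (m≢i m≡i)
... | no  _ with m ≟ j
...   | yes m≡j = ⊥-elim (m≢j m≡j)
...   | no  _   = refl

-- Abstract, so that comparing indices in a proof does not unfold the comparisons inside transpose.
abstract
  swap : ∀ {n} → Fin n → Fin n → Permutation′ n → Permutation′ n
  swap i j σ = transpose i j ∘ₚ σ

  swap-left : ∀ {n} (i j : Fin n) σ → swap i j σ ⟨$⟩ʳ i ≡ σ ⟨$⟩ʳ j
  swap-left i j σ = cong (σ ⟨$⟩ʳ_) (transpose-left i j)

  swap-right : ∀ {n} (i j : Fin n) σ → swap i j σ ⟨$⟩ʳ j ≡ σ ⟨$⟩ʳ i
  swap-right i j σ = cong (σ ⟨$⟩ʳ_) (transpose-right i j)

  swap-other : ∀ {n} (i j : Fin n) σ {m} → m ≢ i → m ≢ j → swap i j σ ⟨$⟩ʳ m ≡ σ ⟨$⟩ʳ m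
  swap-other i j σ m≢i m≢j = cong (σ ⟨$⟩ʳ_) (transpose-other i j _ m≢i m≢j)

perm-injective : ∀ {n} (π : Permutation′ n) {i j} → π ⟨$⟩ʳ i ≡ π ⟨$⟩ʳ j → i ≡ j
perm-injective π eq = trans (sym (inverseˡ π)) (trans (cong (π ⟨$⟩ˡ_) eq) (inverseˡ π))

-- A step that establishes P at one index, keeping it wherever it already holds,
-- can be run through all indices; F is the outcome of a step that gives up.
establish : ∀ {S F : Set} {n} (P : S → Fin n → Set) →
  (∀ s i → F ⊎ Σ S λ s′ → P s′ i × (∀ j → P s j → P s′ j)) →
  S → F ⊎ Σ S λ s → ∀ i → P s i
establish {n = 0}     P improve s = inj₂ (s , λ ())
establish {S} {F} {suc n} P improve s with establish (λ s → P s ∘ suc) improve-suc s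
  where
  improve-suc : ∀ s i → F ⊎ Σ S λ s′ → P s′ (suc i) × (∀ j → P s (suc j) → P s′ (suc j))
  improve-suc s i with improve s (suc i)
  ... | inj₁ f               = inj₁ f
  ... | inj₂ (s′ , p , keep) = inj₂ (s′ , p , keep ∘ suc)
... | inj₁ f = inj₁ f
... | inj₂ (s₁ , p₁) with improve s₁ zero
...   | inj₁ f                = inj₁ f
...   | inj₂ (s₂ , p₂ , keep) = inj₂ (s₂ , λ { zero → p₂ ; (suc i) → keep (suc i) (p₁ i) })

-- Walks and paths

_≟ᵇ_ : ∀ {k} → DecidableEquality (BlockIx k)
_≟ᵇ_ = ×-≡-dec _≟_ _≟_

_≟ᵛ_ : ∀ {Δ k} → DecidableEquality (Vertex Δ k)
_≟ᵛ_ = ⊎-≡-dec (×-≡-dec _≟_ _≟_) _≟ᵇ_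

module _ {Δ k : ℕ} (T : TD Δ k) where
  open TD T

  edge-ends : ∀ {u v b g} (w : Walk T u v) → (b , g) ∈ edges T w →
    block b ∈ vertices T w × node (g , blk b g) ∈ vertices T w
  edge-ends (step (nb refl) stop)       (here refl) = there (here refl) , here refl
  edge-ends (step (nb refl) (step _ _)) (here refl) = there (here refl) , here refl
  edge-ends (step (bn refl) stop)       (here refl) = here refl , there (here refl)
  edge-ends (step (bn refl) (step _ _)) (here refl) = here refl , there (here refl)
  edge-ends (step _ w) (there e∈) with edge-ends w e∈
  ... | b∈ , n∈ = there b∈ , there n∈

  -- An edge determines both its ends, so a recurrence of the first edge would make the starting
  -- vertex occur again.
  edges-unique : ∀ {u v} (w : Walk T u v) → Unique (vertices T w) → Unique (edges T w)
  edges-unique stop _ = []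
  edges-unique (step s w) (u∉ ∷ distinct) = All.¬Any⇒All¬ _ (fresh s u∉) ∷ edges-unique w distinct
    where
    fresh : ∀ {u w′} (s : Adj T u w′) → All (u ≢_) (vertices T w) → ¬ adjEdge T s ∈ edges T w
    fresh (nb refl) u∉ e∈ = All.lookup u∉ (proj₂ (edge-ends w e∈)) refl
    fresh (bn refl) u∉ e∈ = All.lookup u∉ (proj₁ (edge-ends w e∈)) refl

  ShortPath : (Edge Δ k → Set) → ℕ → Vertex Δ k → Vertex Δ k → Set
  ShortPath P n u v = Σ (Path T u v) λ p → len T (Path.walk p) ≤ n × All P (edges T (Path.walk p))

  suffix : ∀ {P u v x} (w : Walk T u v) → Unique (vertices T w) → All P (edges T w) →
    x ∈ vertices T w → ShortPath P (len T w) x v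
  suffix stop       distinct ps (here refl) = path stop distinct , z≤n , ps
  suffix (step s w) distinct ps (here refl) = path (step s w) distinct , ≤-refl , ps
  suffix (step s w) (_ ∷ distinct) (_ ∷ ps) (there x∈) with suffix w distinct ps x∈
  ... | p , short , ps′ = p , m≤n⇒m≤1+n short , ps′

  -- The walks built below may repeat vertices: the avoiding block of a detour can be the target
  -- itself. Cutting out loops only drops edges, so `P` and the length bound survive.
  erase-loops : ∀ {P u v} (w : Walk T u v) → All P (edges T w) → ShortPath P (len T w) u v
  erase-loops stop [] = path stop ([] ∷ []) , z≤n , []
  erase-loops {u = u} (step s w) (p ∷ ps) with erase-loops w ps
  ... | path w′ distinct , short , ps′ with DecMembership._∈?_ _≟ᵛ_ u (vertices T w′)
  ...   | no u∉ = path (step s w′) (All.¬Any⇒All¬ _ u∉ ∷ distinct) , s≤s short , p ∷ ps′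
  ...   | yes u∈ with suffix w′ distinct ps′ u∈
  ...     | q , short′ , ps″ = q , m≤n⇒m≤1+n (≤-trans short′ short) , ps″

  join : ∀ g g′ → g ≢ g′ → (x y : Fin k) → Σ (BlockIx k) λ b → blk b g ≡ x × blk b g′ ≡ y
  join g g′ g≢g′ x y = let b , on , _ = pair g g′ g≢g′ x y in b , on

  two-common⇒≡ : ∀ {b b′ g g′} → g ≢ g′ → blk b g ≡ blk b′ g → blk b g′ ≡ blk b′ g′ → b ≡ b′
  two-common⇒≡ {b} {b′} {g} {g′} g≢g′ p q with pair g g′ g≢g′ (blk b′ g) (blk b′ g′)
  ... | _ , _ , unique = trans (unique b p q) (sym (unique b′ refl refl))

-- Blocks and where they meet `U`

module Linkage {Δ k : ℕ} (2≤Δ : 2 ≤ Δ) (Δ≤k : Δ ≤ k)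
               (T : TD Δ k) (U : BlockIx k) (t : Fin Δ → Vertex Δ k) where
  open TD T

  foot : Fin Δ → Vertex Δ k
  foot g = node (g , blk U g)

  Avoids : BlockIx k → Set
  Avoids b = ∀ g → blk b g ≢ blk U g

  meet-unique : ∀ {b g g′} → b ≢ U → blk b g ≡ blk U g → blk b g′ ≡ blk U g′ → g ≡ g′
  meet-unique {g = g} {g′} b≢U p q with g ≟ g′
  ... | yes g≡g′ = g≡g′
  ... | no  g≢g′ = ⊥-elim (b≢U (two-common⇒≡ T g≢g′ p q))

  -- Of the k ≥ Δ blocks through a node off U at most Δ - 1 meet U.
  avoiding-block : ∀ c x → x ≢ blk U c → Σ (BlockIx k) λ b → blk b c ≡ x × Avoids b
  avoiding-block c x x≢ with another 2≤Δ c
  ... | d , d≢c with ¬∀⟶∃¬ k Meets (λ y → any? λ g → blk (J y) g ≟ blk U g) ¬all-meet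
    where
    J : Fin k → BlockIx k
    J y = proj₁ (join T c d (d≢c ∘ sym) x y)
    J-c : ∀ y → blk (J y) c ≡ x
    J-c y = proj₁ (proj₂ (join T c d (d≢c ∘ sym) x y))
    J-d : ∀ y → blk (J y) d ≡ y
    J-d y = proj₂ (proj₂ (join T c d (d≢c ∘ sym) x y))
    Meets : Fin k → Set
    Meets y = ∃ λ g → blk (J y) g ≡ blk U g
    ¬all-meet : ¬ (∀ y → Meets y)
    ¬all-meet meets = 1+n≰n (≤-trans (injective⇒≤ {f = f} (λ {i} {j} → f-injective i j)) Δ≤k)
      where
      -- If all k blocks met `U`, their meeting groups together with `c` would be k + 1 distinct
      -- groups, more than Δ.
      f : Fin (suc k) → Fin Δ
      f zero    = c
      f (suc y) = proj₁ (meets y)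
      f≢c : ∀ y → f (suc y) ≢ c
      f≢c y eq = x≢ (trans (sym (J-c y)) (subst (λ g → blk (J y) g ≡ blk U g) eq (proj₂ (meets y))))
      f-injective : ∀ i j → f i ≡ f j → i ≡ j
      f-injective zero    zero    _  = refl
      f-injective zero    (suc j) eq = ⊥-elim (f≢c j (sym eq))
      f-injective (suc i) zero    eq = ⊥-elim (f≢c i eq)
      f-injective (suc i) (suc j) eq = cong suc (trans (sym (J-d i)) (trans (cong (λ b → blk b d) Ji≡Jj) (J-d j)))
        where
        Ji≡Jj : J i ≡ J j
        Ji≡Jj = two-common⇒≡ T (f≢c i ∘ sym) (trans (J-c i) (sym (J-c j)))
          (trans (proj₂ (meets i)) (sym (subst (λ g → blk (J j) g ≡ blk U g) (sym eq) (proj₂ (meets j)))))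
  ... | y , ¬meets = let b , b-c , _ = join T c d (d≢c ∘ sym) x y in b , b-c , λ g eq → ¬meets (g , eq)

  -- Targets at a node of `U` and their servers

  At : Fin Δ → Vertex Δ k → Set
  At g (inj₁ (g′ , x)) = g′ ≡ g × x ≡ blk U g
  At g (inj₂ b)        = b ≢ U × blk b g ≡ blk U g

  at? : ∀ g v → Dec (At g v)
  at? g (inj₁ (g′ , x)) = (g′ ≟ g) ×-dec (x ≟ blk U g)
  at? g (inj₂ b)        = ¬? (b ≟ᵇ U) ×-dec (blk b g ≟ blk U g)

  at-unique : ∀ v {g g′} → At g v → At g′ v → g ≡ g′
  at-unique (inj₁ _) (p , _)   (q , _)  = trans (sym p) q
  at-unique (inj₂ b) (b≢U , p) (_ , q) = meet-unique b≢U p q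

  at-foot : ∀ {g v} → v ≡ foot g → At g v
  at-foot refl = refl , refl

  -- Serving the node itself first keeps the other Δ - 1 edges at it free.
  Serves : Fin Δ → Fin Δ → Set
  Serves g i = ∀ j → At g (t j) → At g (t i) × (t j ≡ foot g → t i ≡ foot g)

  server : ∀ g → (∃ λ i → At g (t i) × Serves g i) ⊎ (∀ j → ¬ At g (t j))
  server g with any? (λ i → t i ≟ᵛ foot g) | any? (λ i → at? g (t i))
  ... | yes (i , eq) | _            = inj₁ (i , at-foot eq , λ _ _ → at-foot eq , λ _ → eq)
  ... | no none      | yes (i , at) = inj₁ (i , at , λ j _ → at , λ eq → ⊥-elim (none (j , eq)))
  ... | no _         | no none      = inj₂ λ j at → none (j , at)

  -- The groups are treated in turn, a server of `g` being swapped onto `g` if any target is at `g`.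
  -- No step gives up, hence `F = ⊥`.
  serving-permutation : Σ (Permutation′ Δ) λ σ → ∀ i → Serves (σ ⟨$⟩ʳ i) i
  serving-permutation with establish {F = ⊥} Served improve idₚ
    where
    Served : Permutation′ Δ → Fin Δ → Set
    Served σ g = ∀ i → σ ⟨$⟩ʳ i ≡ g → Serves g i
    improve : ∀ σ g → ⊥ ⊎ Σ (Permutation′ Δ) λ σ′ → Served σ′ g × (∀ g′ → Served σ g′ → Served σ′ g′)
    improve σ g with server g
    ... | inj₂ none = inj₂ (σ , (λ i _ j at → ⊥-elim (none j at)) , λ _ s → s)
    ... | inj₁ (r , at-r , serves) = inj₂ (σ′ , now , keep)
      where
      q = σ ⟨$⟩ˡ g
      σ′ = swap r q σ
      σ′r≡g : σ′ ⟨$⟩ʳ r ≡ g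
      σ′r≡g = trans (swap-left r q σ) (inverseʳ σ)
      now : Served σ′ g
      now i eq = subst (Serves g) (perm-injective σ′ (trans σ′r≡g (sym eq))) serves
      keep : ∀ g′ → Served σ g′ → Served σ′ g′
      keep g′ served i eq with g′ ≟ g
      ... | yes refl = now i eq
      ... | no g′≢g with i ≟ r | i ≟ q
      ...   | yes refl | _        = ⊥-elim (g′≢g (trans (sym eq) σ′r≡g))
      ...   | no i≢r   | no i≢q   = served i (trans (sym (swap-other r q σ i≢r i≢q)) eq)
      -- The swap puts `q` on `g′`, the old group of `r`. A target at `g′` would force `t r` to be
      -- at `g′` as well as at `g`; so there is none, and any index serves `g′`.
      ...   | no _     | yes refl = λ j at → ⊥-elim (g′≢g (at-unique (t r) (proj₁ (served r σr≡g′ j at)) at-r))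
        where
        σr≡g′ : σ ⟨$⟩ʳ r ≡ g′
        σr≡g′ = trans (sym (swap-right r q σ)) eq
  ... | inj₂ (σ , served) = σ , λ i → served (σ ⟨$⟩ʳ i) i refl

  -- Exchanging groups among the non-direct targets

  module Assigned (σ₀ : Permutation′ Δ) (serves : ∀ i → Serves (σ₀ ⟨$⟩ʳ i) i) where

    Direct : Fin Δ → Set
    Direct i = At (σ₀ ⟨$⟩ʳ i) (t i)

    direct? : ∀ i → Dec (Direct i)
    direct? i = at? (σ₀ ⟨$⟩ʳ i) (t i)

    -- The group of the off-U node through which the path to v arrives; s is used when v leaves a choice.
    entry : Vertex Δ k → Fin Δ → Fin Δ
    entry (inj₂ _) s = s
    entry (inj₁ (g , x)) s with x ≟ blk U g
    ... | yes _ = s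
    ... | no  _ = g

    -- Built from `σ₀`, so later exchanges do not change it, and copies of the same block target are
    -- entered through different groups.
    h : Fin Δ → Fin Δ
    h i = entry (t i) (σ₀ ⟨$⟩ʳ i)

    Far : Vertex Δ k → Set
    Far (inj₁ _) = ⊥
    Far (inj₂ b) = Avoids b

    far? : ∀ v → Dec (Far v)
    far? (inj₁ _) = no λ ()
    far? (inj₂ b) = all? λ g → ¬? (blk b g ≟ blk U g)

    far-entry : ∀ v {s} → Far v → entry v s ≡ s
    far-entry (inj₂ _) _ = refl

    Active : Fin Δ → Set
    Active i = ¬ Direct i × t i ≢ block U

    active? : ∀ i → Dec (Active i)
    active? i = ¬? (direct? i) ×-dec ¬? (t i ≟ᵛ block U)

    Clash : Permutation′ Δ → Fin Δ → Set
    Clash σ i = Active i × σ ⟨$⟩ʳ i ≡ h i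

    Extends : Permutation′ Δ → Set
    Extends σ = ∀ i → Direct i → σ ⟨$⟩ʳ i ≡ σ₀ ⟨$⟩ʳ i

    -- The detour runs over an arbitrary block avoiding U, so no other target may be such a block:
    -- if there is one (it is then unique, as its h is taken from σ₀), it is made the clashing one.
    OnlyClash : Permutation′ Δ → Fin Δ → Set
    OnlyClash σ i = ∀ j → ¬ Direct j → h j ≡ σ ⟨$⟩ʳ i × (Far (t j) → j ≡ i)

    extends-swap : ∀ {σ} → Extends σ → ∀ i j → ¬ Direct i → ¬ Direct j → Extends (swap i j σ)
    extends-swap {σ} ext i j ¬di ¬dj m dm =
      trans (swap-other i j σ (λ { refl → ¬di dm }) (λ { refl → ¬dj dm })) (ext m dm)

    -- A clash is resolved by an exchange of groups. If no partner is suitable, all non-direct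
    -- targets share one value of `h`, so only the index that `σ` sends there can clash; a far
    -- target, if any, is given that group.
    routing : Σ (Permutation′ Δ) λ σ → Extends σ × (∀ i → Clash σ i → OnlyClash σ i)
    routing with establish {F = Stuck} (λ s i → ¬ Clash (proj₁ s) i) improve (σ₀ , λ _ _ → refl)
      where
      Stuck : Set
      Stuck = Σ (Permutation′ Δ) λ σ → Extends σ × ∃ λ i → Active i ×
        (∀ j → ¬ Direct j → Active j × h j ≡ σ ⟨$⟩ʳ i)
      improve : (s : Σ (Permutation′ Δ) Extends) → ∀ i → Stuck ⊎ Σ (Σ (Permutation′ Δ) Extends) λ s′ →
        ¬ Clash (proj₁ s′) i × (∀ j → ¬ Clash (proj₁ s) j → ¬ Clash (proj₁ s′) j)
      improve (σ , ext) i with active? i ×-dec (σ ⟨$⟩ʳ i ≟ h i)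
      ... | no ok = inj₂ ((σ , ext) , ok , λ _ p → p)
      ... | yes (act , σi≡hi)
        -- Such a `j` can take the group `σ i` without clashing, for instance because its target is
        -- `U`. Index `i` is then safe too, as `σ j` differs from `σ i`, which is `h i`.
        with any? (λ j → ¬? (direct? j) ×-dec ¬? (active? j ×-dec (h j ≟ σ ⟨$⟩ʳ i)))
      ...   | no none = inj₁ (σ , ext , i , act , all-same)
        where
        all-same : ∀ j → ¬ Direct j → Active j × h j ≡ σ ⟨$⟩ʳ i
        all-same j ¬dj with active? j ×-dec (h j ≟ σ ⟨$⟩ʳ i)
        ... | yes p = p
        ... | no ¬p = ⊥-elim (none (j , ¬dj , ¬p))
      ...   | yes (j , ¬dj , free) = inj₂ ((σ′ , extends-swap {σ} ext i j (proj₁ act) ¬dj) , clear-i , keep)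
        where
        σ′ = swap i j σ
        clear-i : ¬ Clash σ′ i
        clear-i (_ , eq) = free (subst (λ m → Active m × h m ≡ σ ⟨$⟩ʳ i) i≡j (act , sym σi≡hi))
          where
          i≡j : i ≡ j
          i≡j = perm-injective σ (trans σi≡hi (trans (sym eq) (swap-left i j σ)))
        keep : ∀ m → ¬ Clash σ m → ¬ Clash σ′ m
        keep m ok with m ≟ i | m ≟ j
        ... | yes refl | _        = clear-i
        ... | no _     | yes refl = λ (act-j , eq) →
          free (act-j , trans (sym eq) (swap-right i j σ))
        ... | no m≢i   | no m≢j   = λ (act-m , eq) →
          ok (act-m , trans (sym (swap-other i j σ m≢i m≢j)) eq)
    ... | inj₂ ((σ , ext) , ok) = σ , ext , λ i clash → ⊥-elim (ok i clash)
    ... | inj₁ (σ , ext , i , (¬di , _) , same) with any? (λ j → ¬? (direct? j) ×-dec far? (t j))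
    ...   | no none = σ , ext , λ m (act-m , eq) j ¬dj →
              trans (proj₂ (same j ¬dj)) (trans (sym (proj₂ (same m (proj₁ act-m)))) (sym eq)) ,
              λ far → ⊥-elim (none (j , ¬dj , far))
    ...   | yes (r , ¬dr , far-r) = σ′ , extends-swap {σ} ext i r ¬di ¬dr , only
      where
      σ′ = swap i r σ
      σ′r≡σi : σ′ ⟨$⟩ʳ r ≡ σ ⟨$⟩ʳ i
      σ′r≡σi = swap-right i r σ
      only : ∀ m → Clash σ′ m → OnlyClash σ′ m
      only m ((¬dm , _) , eq) j ¬dj = trans hj≡σi (sym σ′m≡σi) , λ far-j → trans (j≡r far-j) (sym m≡r)
        where
        hj≡σi = proj₂ (same j ¬dj)
        σ′m≡σi : σ′ ⟨$⟩ʳ m ≡ σ ⟨$⟩ʳ i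
        σ′m≡σi = trans eq (proj₂ (same m ¬dm))
        m≡r : m ≡ r
        m≡r = perm-injective σ′ (trans σ′m≡σi (sym σ′r≡σi))
        j≡r : Far (t j) → j ≡ r
        j≡r far-j = perm-injective σ₀ (trans (sym (far-entry (t j) far-j))
          (trans hj≡σi (trans (sym (proj₂ (same r ¬dr))) (far-entry (t r) far-r))))

    -- Block through which a non-direct path returns to the node of U in group g.
    -- The transposition sends the value of g to U's own position, so the value of i ≠ g avoids U.
    private
      side : Fin Δ → Fin Δ
      side g = proj₁ (another 2≤Δ g)

      position : Fin Δ → Fin Δ → Fin k
      position g s = transpose (inject≤ g Δ≤k) (blk U (side g)) ⟨$⟩ʳ inject≤ s Δ≤k

      return-join : ∀ g s → Σ (BlockIx k) λ b → blk b g ≡ blk U g × blk b (side g) ≡ position g s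
      return-join g s = join T g (side g) (proj₂ (another 2≤Δ g) ∘ sym) (blk U g) (position g s)

      position-injective : ∀ g {s s′} → position g s ≡ position g s′ → s ≡ s′
      position-injective g eq = inject≤-injective Δ≤k Δ≤k _ _ (perm-injective (transpose _ _) eq)

    return : Fin Δ → Fin Δ → BlockIx k
    return g s = proj₁ (return-join g s)

    return-foot : ∀ g s → blk (return g s) g ≡ blk U g
    return-foot g s = proj₁ (proj₂ (return-join g s))

    return-injective : ∀ g {s s′} → return g s ≡ return g s′ → s ≡ s′
    return-injective g {s} {s′} eq = position-injective g
      (trans (sym (proj₂ (proj₂ (return-join g s))))
        (trans (cong (λ b → blk b (side g)) eq) (proj₂ (proj₂ (return-join g s′)))))

    return≢U : ∀ g {s} → s ≢ g → return g s ≢ U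
    return≢U g {s} s≢g eq = s≢g (position-injective g
      (trans (sym (proj₂ (proj₂ (return-join g s))))
        (trans (cong (λ b → blk b (side g)) eq) (sym (transpose-left (inject≤ g Δ≤k) (blk U (side g)))))))

    -- Ownership of edges

    module Routed (σ : Permutation′ Δ) (ext : Extends σ)
                  (only : ∀ i → Clash σ i → OnlyClash σ i) where

      -- The index serving this group under `σ₀` is direct and `σ` keeps direct indices in place, so
      -- it is `i`. Hence no target lies at the node of `U` through which a non-direct path leaves.
      visited⇒direct : ∀ i j → At (σ ⟨$⟩ʳ i) (t j) → Direct i × (t j ≡ foot (σ ⟨$⟩ʳ i) → t i ≡ foot (σ ⟨$⟩ʳ i))
      visited⇒direct i j at = subst Direct m≡i direct-m ,
        λ eq → subst (λ m → t m ≡ foot (σ ⟨$⟩ʳ i)) m≡i (proj₂ (serves-m j at) eq)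
        where
        m = σ₀ ⟨$⟩ˡ (σ ⟨$⟩ʳ i)
        serves-m : Serves (σ ⟨$⟩ʳ i) m
        serves-m = subst (λ g → Serves g m) (inverseʳ σ₀) (serves m)
        direct-m : Direct m
        direct-m = subst (λ g → At g (t m)) (sym (inverseʳ σ₀)) (proj₁ (serves-m j at))
        m≡i : m ≡ i
        m≡i = perm-injective σ (trans (ext m direct-m) (inverseʳ σ₀))

      -- The condition in `leave` says that a path whose target is the foot stops there, which
      -- leaves the other edges at the foot to the return blocks.
      data FootEdge (i : Fin Δ) (b : BlockIx k) (g : Fin Δ) : Set where
        leave  : g ≡ σ ⟨$⟩ʳ i → (t i ≡ foot g → b ≡ U) → FootEdge i b g
        arrive : t i ≡ foot g → ¬ Direct i → b ≡ return g (σ₀ ⟨$⟩ʳ i) → FootEdge i b g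

      data NearEdge (i : Fin Δ) (b : BlockIx k) (g : Fin Δ) : Set where
        cross : ¬ Direct i → blk b (σ ⟨$⟩ʳ i) ≡ blk U (σ ⟨$⟩ʳ i) → NearEdge i b g
        tail  : ∀ f → At f (t i) → blk b f ≡ blk U f → g ≡ σ₀ ⟨$⟩ʳ i → NearEdge i b g

      data FarEdge (i : Fin Δ) (g : Fin Δ) : Set where
        tail   : ¬ Direct i → Far (t i) → g ≡ σ₀ ⟨$⟩ʳ i → FarEdge i g
        detour : Clash σ i → FarEdge i g

      -- Whether an edge (b , g) has its node on U, or else its block meets U, or neither,
      -- depends on the edge only, so two owners are compared within one of the three classes.
      data Own (i : Fin Δ) : Edge Δ k → Set where
        footed : ∀ {b g} → blk b g ≡ blk U g → FootEdge i b g → Own i (b , g)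
        near   : ∀ {b g} → blk b g ≢ blk U g → NearEdge i b g → Own i (b , g)
        far    : ∀ {b g} → Avoids b → FarEdge i g → Own i (b , g)

      near-meets : ∀ {i b g} → NearEdge i b g → ¬ Avoids b
      near-meets (cross _ on)    av = av _ on
      near-meets (tail _ _ on _) av = av _ on

      -- As `t j` is the foot, serving the node first makes `t i` the foot too, so `i` uses only the
      -- edge to `U` there, and a return block differs from `U`.
      leave-arrive : ∀ {i j b g} → g ≡ σ ⟨$⟩ʳ i → (t i ≡ foot g → b ≡ U) →
        t j ≡ foot g → ¬ Direct j → b ≡ return g (σ₀ ⟨$⟩ʳ j) → ⊥
      leave-arrive {i} {j} {g = g} refl only-U tj ¬dj b≡ =
        return≢U g {σ₀ ⟨$⟩ʳ j} (λ eq → ¬dj (subst (λ f → At f (t j)) (sym eq) (at-foot tj)))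
          (trans (sym b≡) (only-U (proj₂ (visited⇒direct i j (at-foot tj)) tj)))

      -- The block is not `U`, so it meets `U` only where `i` leaves; then `t j` is at that node and
      -- `i` would be direct.
      cross-tail : ∀ {i j b g f} → blk b g ≢ blk U g → ¬ Direct i → blk b (σ ⟨$⟩ʳ i) ≡ blk U (σ ⟨$⟩ʳ i) →
        At f (t j) → blk b f ≡ blk U f → ⊥
      cross-tail {i} {j} off ¬di on at on′ with meet-unique (λ { refl → off refl }) on on′
      ... | refl = ¬di (proj₁ (visited⇒direct i j at))

      foot-owner : ∀ {i j b g} → FootEdge i b g → FootEdge j b g → i ≡ j
      foot-owner (leave p _)      (leave q _)      = perm-injective σ (trans (sym p) q)
      foot-owner (leave p only-U) (arrive tj ¬d e) = ⊥-elim (leave-arrive p only-U tj ¬d e)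
      foot-owner (arrive ti ¬d e) (leave q only-U) = ⊥-elim (leave-arrive q only-U ti ¬d e)
      foot-owner {g = g} (arrive _ _ e) (arrive _ _ e′) =
        perm-injective σ₀ (return-injective g (trans (sym e) e′))

      near-owner : ∀ {i j b g} → blk b g ≢ blk U g → NearEdge i b g → NearEdge j b g → i ≡ j
      near-owner off (cross _ on)     (cross _ on′)    = perm-injective σ (meet-unique (λ { refl → off refl }) on on′)
      near-owner off (cross ¬d on)    (tail _ at on′ _) = ⊥-elim (cross-tail off ¬d on at on′)
      near-owner off (tail _ at on _) (cross ¬d on′)   = ⊥-elim (cross-tail off ¬d on′ at on)
      near-owner off (tail _ _ _ p)   (tail _ _ _ q)   = perm-injective σ₀ (trans (sym p) q)

      -- Tails enter through distinct groups of `σ₀`. `OnlyClash` settles the rest: a far target is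
      -- the clashing one, and two clashes share a value of `σ`.
      far-owner : ∀ {i j g} → FarEdge i g → FarEdge j g → i ≡ j
      far-owner (tail _ _ p)    (tail _ _ q)    = perm-injective σ₀ (trans (sym p) q)
      far-owner (tail ¬d far-i _) (detour clash)  = proj₂ (only _ clash _ ¬d) far-i
      far-owner (detour clash)  (tail ¬d far-j _) = sym (proj₂ (only _ clash _ ¬d) far-j)
      far-owner (detour ((¬d , _) , p)) (detour clash) =
        perm-injective σ (trans p (proj₁ (only _ clash _ ¬d)))

      owner-unique : ∀ {i j e} → Own i e → Own j e → i ≡ j
      owner-unique (footed _ p)  (footed _ q)  = foot-owner p q
      owner-unique (near off p)  (near _ q)    = near-owner off p q
      owner-unique (far _ p)     (far _ q)     = far-owner p q
      owner-unique (footed on _) (near off _)  = ⊥-elim (off on)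
      owner-unique (footed on _) (far av _)    = ⊥-elim (av _ on)
      owner-unique (near off _)  (footed on _) = ⊥-elim (off on)
      owner-unique (near _ p)    (far av _)    = ⊥-elim (near-meets p av)
      owner-unique (far av _)    (footed on _) = ⊥-elim (av _ on)
      owner-unique (far av _)    (near _ q)    = ⊥-elim (near-meets q av)

      -- Walks made of owned edges

      OwnWalk : Fin Δ → Vertex Δ k → Vertex Δ k → ℕ → Set
      OwnWalk i u v n = Σ (Walk T u v) λ w → len T w ≤ n × All (Own i) (edges T w)

      -- Supplies the node off `U` and the last steps to the target. The target is passed as a
      -- variable `v` so that `entry` computes in each case.
      tail-walk : ∀ i → Active i → ∀ v → t i ≡ v →
        Σ (Fin k) λ x → x ≢ blk U (entry v (σ₀ ⟨$⟩ʳ i)) × OwnWalk i (node (entry v (σ₀ ⟨$⟩ʳ i) , x)) v 2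
      tail-walk i (¬d , ti≢U) (inj₁ (g , x)) ti with x ≟ blk U g
      ... | no x≢ = x , x≢ , stop , z≤n , []
      ... | yes refl = blk b s , off , step (nb refl) (step (bn on) stop) , ≤-refl ,
          near off (tail g (at-foot ti) on refl) ∷ footed on (arrive ti ¬d refl) ∷ []
        where
        s = σ₀ ⟨$⟩ʳ i
        b = return g s
        on = return-foot g s
        s≢g : s ≢ g
        s≢g eq = ¬d (at-foot (trans ti (cong foot (sym eq))))
        off : blk b s ≢ blk U s
        off eq = s≢g (meet-unique (return≢U g s≢g) eq on)
      tail-walk i (¬d , ti≢U) (inj₂ b) ti with any? (λ g → blk b g ≟ blk U g)
      ... | no none = blk b s , av s , step (nb refl) stop , s≤s z≤n ,
          far av (tail ¬d (subst Far (sym ti) av) refl) ∷ []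
        where
        s = σ₀ ⟨$⟩ʳ i
        av : Avoids b
        av g eq = none (g , eq)
      ... | yes (g , on) = blk b s , off , step (nb refl) stop , s≤s z≤n ,
          near off (tail g (subst (At g) (sym ti) (b≢U , on)) on refl) ∷ []
        where
        s = σ₀ ⟨$⟩ʳ i
        b≢U : b ≢ U
        b≢U eq = ti≢U (trans ti (cong block eq))
        off : blk b s ≢ blk U s
        off eq = ¬d (subst (At s) (sym ti) (b≢U , eq))

      approach : ∀ i → Active i → ∀ x → x ≢ blk U (h i) → OwnWalk i (node (h i , x)) (t i) 2 →
        OwnWalk i (block U) (t i) 7
      approach i act@(¬d , _) x x≢ (w , short , own) with σ ⟨$⟩ʳ i ≟ h i
      ... | no σi≢hi with join T (σ ⟨$⟩ʳ i) (h i) σi≢hi (blk U (σ ⟨$⟩ʳ i)) x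
      ...   | X , X-u , X-e = step (bn refl) (step (nb X-u) (step (bn X-e) w)) ,
              s≤s (s≤s (s≤s (≤-trans short (s≤s (s≤s z≤n))))) ,
              footed refl (leave refl λ _ → refl) ∷
              footed X-u (leave refl λ ti → ⊥-elim (¬d (proj₁ (visited⇒direct i i (at-foot ti))))) ∷
              near (λ eq → x≢ (trans (sym X-e) eq)) (cross ¬d X-u) ∷ own
      -- Two nodes of one group share no block, hence the detour over `Y`. Any group `d` other than
      -- `σ i` will do, since all nodes of `Y` are off `U`. The five steps plus a tail of at most
      -- two give the bound 7.
      approach i act@(¬d , _) x x≢ (w , short , own) | yes σi≡hi
        with avoiding-block (h i) x x≢ | another 2≤Δ (σ ⟨$⟩ʳ i)
      ... | Y , Y-e , av | d , d≢σi with join T (σ ⟨$⟩ʳ i) d (d≢σi ∘ sym) (blk U (σ ⟨$⟩ʳ i)) (blk Y d)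
      ...   | X , X-u , X-n =
              step (bn refl) (step (nb X-u) (step (bn X-n) (step (nb refl) (step (bn Y-e) w)))) ,
              s≤s (s≤s (s≤s (s≤s (s≤s short)))) ,
              footed refl (leave refl λ _ → refl) ∷
              footed X-u (leave refl λ ti → ⊥-elim (¬d (proj₁ (visited⇒direct i i (at-foot ti))))) ∷
              near (λ eq → av d (trans (sym X-n) eq)) (cross ¬d X-u) ∷
              far av (detour (act , σi≡hi)) ∷ far av (detour (act , σi≡hi)) ∷ own

      direct-walk : ∀ i v → t i ≡ v → At (σ ⟨$⟩ʳ i) v → OwnWalk i (block U) v 7
      direct-walk i (inj₁ _) ti (refl , refl) =
        step (bn refl) stop , s≤s z≤n , footed refl (leave refl λ _ → refl) ∷ []
      direct-walk i (inj₂ b) ti (b≢U , on) =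
        step (bn refl) (step (nb on) stop) , s≤s (s≤s z≤n) ,
        footed refl (leave refl λ _ → refl) ∷
        footed on (leave refl λ eq → ⊥-elim (block≢foot (trans (sym ti) eq))) ∷ []
        where
        block≢foot : block b ≢ foot (σ ⟨$⟩ʳ i)
        block≢foot ()

      own-walk : ∀ i → OwnWalk i (block U) (t i) 7
      own-walk i with direct? i | t i ≟ᵛ block U
      ... | yes d | _ = direct-walk i (t i) refl (subst (λ g → At g (t i)) (sym (ext i d)) d)
      ... | no ¬d | yes ti≡U = subst (λ v → OwnWalk i (block U) v 7) (sym ti≡U) (stop , z≤n , [])
      ... | no ¬d | no ti≢U with tail-walk i (¬d , ti≢U) (t i) refl
      ...   | x , x≢ , w = approach i (¬d , ti≢U) x x≢ w

      -- From owned walks to edge-disjoint paths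

      own-path : ∀ i → ShortPath T (Own i) 7 (block U) (t i)
      own-path i with own-walk i
      ... | w , short , own with erase-loops T w own
      ...   | p , shorter , own′ = p , ≤-trans shorter short , own′

      own-edges : ∀ i → List (Edge Δ k)
      own-edges i = edges T (Path.walk (proj₁ (own-path i)))

      own-edges-disjoint : ∀ {i j} → i ≢ j → Disjoint (own-edges i) (own-edges j)
      own-edges-disjoint {i} {j} i≢j (e∈i , e∈j) = i≢j (owner-unique
        (All.lookup (proj₂ (proj₂ (own-path i))) e∈i) (All.lookup (proj₂ (proj₂ (own-path j))) e∈j))

      paths-edge-disjoint : Unique (concatMap own-edges (allFin Δ))
      paths-edge-disjoint = Unique.concat⁺
        (All.map⁺ (All.universal (λ i → edges-unique T _ (Path.distinct (proj₁ (own-path i)))) (allFin Δ)))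
        (AllPairs.map⁺ (AllPairs.map own-edges-disjoint (Unique.allFin⁺ Δ)))

theorem3 : (k Δ : ℕ) → 2 ≤ k → 2 ≤ Δ → Δ ≤ k →
    (T : TD Δ k) → (U : BlockIx k) → (t : Fin Δ → Vertex Δ k) →
    Σ ((i : Fin Δ) → Path T (block U) (t i)) (λ π →
    ((i : Fin Δ) → len T (Path.walk (π i)) ≤ 7) ×
    Unique (concatMap (λ i → edges T (Path.walk (π i))) (allFin Δ)))
theorem3 k Δ _ 2≤Δ Δ≤k T U t =
  (λ i → proj₁ (own-path i)) , (λ i → proj₁ (proj₂ (own-path i))) , paths-edge-disjoint
  where
  open Linkage 2≤Δ Δ≤k T U t
  open Assigned (proj₁ serving-permutation) (proj₂ serving-permutation)
  open Routed (proj₁ routing) (proj₁ (proj₂ routing)) (proj₂ (proj₂ routing))
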